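{- The axiomatic system $\mathbf{K4}^\circ$ is sound and strongly complete with respect to the class of transitive frames ($4$-frames). That is, with $F$ the class of transitive frames: every theorem of $\mathbf{K4}^\circ$ is valid on $F$ (soundness), and for every set $\Gamma\cup\{\phi\}$ of $\mathcal{L}(\circ)$-formulas, if $\Gamma\vDash_F\phi$ then $\Gamma\vdash_{\mathbf{K4}^\circ}\phi$ (strong completeness).
   Context: Let $\mathbf{P}$ be a set of propositional variables, with $p,q\in\mathbf{P}$ distinct. The language $\mathcal{L}(\circ)$ is given by $\phi::=r\mid\neg\phi\mid(\phi\land\phi)\mid\circ\phi$ with $r\in\mathbf{P}$; other Boolean connectives and $\top$ are the usual abbreviations. A frame is $\langle S,R\rangle$ with $S$ a nonempty set and $R\subseteq S\times S$; it is transitive if $R$ is. A model based on a frame is $\mathcal{M}=\langle S,R,V\rangle$ with $V:\mathbf{P}\to\mathcal{P}(S)$. Satisfaction: $\mathcal{M},s\vDash r$ iff $s\in V(r)$; Booleans as usual; $\mathcal{M},s\vDash\circ\phi$ iff ($\mathcal{M},s\vDash\phi$ implies that $\mathcal{M},t\vDash\phi$ for all $t$ with $sRt$). For a class $F$ of frames, $\phi$ is valid on $F$ if $\mathcal{M},s\vDash\phi$ for every model $\mathcal{M}$ based on a frame in $F$ and every $s$ in $\mathcal{M}$; $\Gamma\vDash_F\phi$ means: for every model $\mathcal{M}$ based on a frame in $F$ and every $s$ in $\mathcal{M}$, if $\mathcal{M},s\vDash\gamma$ for all $\gamma\in\Gamma$ then $\mathcal{M},s\vDash\phi$. The system $\mathbf{K}^\circ$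 has as axioms all propositional tautologies, $\circ\top$, $\neg p\to\circ p$, and $\circ p\land\circ q\to\circ(p\land q)$, and as inference rules uniform substitution, modus ponens, and the rule: from $\phi\to\psi$ infer $\circ\phi\land\phi\to\circ\psi$. The system $\mathbf{K4}^\circ$ is $\mathbf{K}^\circ$ plus the axiom $\circ p\land p\to\circ\circ p$. A derivation from $\Gamma$ to $\phi$ in a system, written $\Gamma\vdash\phi$ (with the system as subscript), is a finite sequence of $\mathcal{L}(\circ)$-formulas (ending in $\phi$) in which each formula is either an instantiation of an axiom, or an element of $\Gamma$, or the result of applying an inference rule to prior formulas in the sequence. A theorem is a formula $\phi$ for which there is a derivation from $\emptyset$ to $\phi$. -}

module Defs where

open import Data.Bool.Base using (Bool; true; not) renaming (_∧_ to _∧ᵇ_)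
open import Data.List.Base using (List; []; _∷_)
open import Data.List.Membership.Propositional using (_∈_)
open import Data.Product.Base using (_×_; ∃-syntax)
open import Level using (Level; _⊔_; suc)
open import Relation.Binary.Core using (Rel)
open import Relation.Binary.Definitions using (Transitive)
open import Relation.Binary.PropositionalEquality.Core using (_≡_)
open import Relation.Nullary.Negation.Core using () renaming (¬_ to Not)
open import Relation.Unary using (Pred; ∅)

infix  9 ○_ ¬_
infixr 7 _∧_
infixr 5 _⇒_
infix  8 _[_]
infix  4 _⟨_⟩⊨_ _⊨⟨_⟩_ _⊢⟨_⟩_

private variable
  ℓ a g : Level

------------------------------------------------------------------------
-- Language

data Form (P : Set ℓ) : Set ℓ where
  var : P → Form P
  ¬_  : Form P → Form P
  _∧_ : Form P → Form P → Form P
  ○_  : Form P → Form P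

private variable
  P : Set ℓ

_⇒_ : Form P → Form P → Form P
φ ⇒ ψ = ¬ (φ ∧ ¬ ψ)

-- There is no primitive constant, so ⊤ abbreviates p ⇒ p for a chosen p.
top : P → Form P
top p = var p ⇒ var p

_[_] : Form P → (P → Form P) → Form P
var r   [ σ ] = σ r
(¬ φ)   [ σ ] = ¬ (φ [ σ ])
(φ ∧ ψ) [ σ ] = (φ [ σ ]) ∧ (ψ [ σ ])
(○ φ)   [ σ ] = ○ (φ [ σ ])

------------------------------------------------------------------------
-- Semantics

record Frame (ℓ : Level) : Set (suc ℓ) where
  field
    S        : Set ℓ
    R        : Rel S ℓ
    nonempty : S

FrameClass : (ℓ a : Level) → Set (suc ℓ ⊔ suc a)
FrameClass ℓ a = Pred (Frame ℓ) a

TransitiveFrames : FrameClass ℓ ℓ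
TransitiveFrames F = Transitive (Frame.R F)

record Model (P : Set ℓ) : Set (suc ℓ) where
  field
    frame : Frame ℓ
  open Frame frame public
  field
    V : P → Pred S ℓ

_⟨_⟩⊨_ : {P : Set ℓ} (M : Model P) → Model.S M → Form P → Set ℓ
M ⟨ s ⟩⊨ var r   = Model.V M r s
M ⟨ s ⟩⊨ (¬ φ)   = Not (M ⟨ s ⟩⊨ φ)
M ⟨ s ⟩⊨ (φ ∧ ψ) = (M ⟨ s ⟩⊨ φ) × (M ⟨ s ⟩⊨ ψ)
M ⟨ s ⟩⊨ (○ φ)   = M ⟨ s ⟩⊨ φ → ∀ t → Model.R M s t → M ⟨ t ⟩⊨ φ

Valid : {P : Set ℓ} → FrameClass ℓ a → Form P → Set (suc ℓ ⊔ a)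
Valid {P = P} F φ = (M : Model P) → F (Model.frame M) → ∀ s → M ⟨ s ⟩⊨ φ

_⊨⟨_⟩_ : {P : Set ℓ} →
         Pred (Form P) g → FrameClass ℓ a → Form P → Set (suc ℓ ⊔ g ⊔ a)
_⊨⟨_⟩_ {P = P} Γ F φ =
  (M : Model P) → F (Model.frame M) →
  ∀ s → (∀ γ → Γ γ → M ⟨ s ⟩⊨ γ) → M ⟨ s ⟩⊨ φ

------------------------------------------------------------------------
-- Axioms

-- Boolean evaluation, with the formulas ○ φ treated as atoms alongside
-- the propositional variables.
eval : (P → Bool) → (Form P → Bool) → Form P → Bool
eval v w (var r) = v r
eval v w (¬ φ)   = not (eval v w φ)
eval v w (φ ∧ ψ) = eval v w φ ∧ᵇ eval v w ψ
eval v w (○ φ)   = w φ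

Tautology : Form P → Set _
Tautology φ = ∀ v w → eval v w φ ≡ true

data K°Axiom {P : Set ℓ} (p q : P) : Pred (Form P) ℓ where
  taut : ∀ {φ} → Tautology φ → K°Axiom p q φ
  ○⊤   : K°Axiom p q (○ top p)
  ¬⇒○  : K°Axiom p q (¬ var p ⇒ ○ var p)
  ○∧   : K°Axiom p q (○ var p ∧ ○ var q ⇒ ○ (var p ∧ var q))

data K4°Axiom {P : Set ℓ} (p q : P) : Pred (Form P) ℓ where
  K°  : ∀ {φ} → K°Axiom p q φ → K4°Axiom p q φ
  ax4 : K4°Axiom p q (○ var p ∧ var p ⇒ ○ ○ var p)

------------------------------------------------------------------------
-- Derivations

data Justified {P : Set ℓ} (Ax : Pred (Form P) a) (Γ : Pred (Form P) g)
               (prior : List (Form P)) : Form P → Set (ℓ ⊔ a ⊔ g) where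
  axiom  : ∀ {φ} → Ax φ → (σ : P → Form P) → Justified Ax Γ prior (φ [ σ ])
  member : ∀ {φ} → Γ φ → Justified Ax Γ prior φ
  subst  : ∀ {φ} → φ ∈ prior → (σ : P → Form P) →
           Justified Ax Γ prior (φ [ σ ])
  mp     : ∀ {φ ψ} → (φ ⇒ ψ) ∈ prior → φ ∈ prior → Justified Ax Γ prior ψ
  ○-rule : ∀ {φ ψ} → (φ ⇒ ψ) ∈ prior →
           Justified Ax Γ prior (○ φ ∧ φ ⇒ ○ ψ)

-- Sequences are listed in reverse: the last formula is the head.
data IsDerivation {P : Set ℓ} (Ax : Pred (Form P) a) (Γ : Pred (Form P) g) :
                  List (Form P) → Set (ℓ ⊔ a ⊔ g) where
  []  : IsDerivation Ax Γ []
  _∷_ : ∀ {φ prior} → Justified Ax Γ prior φ → IsDerivation Ax Γ prior →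
        IsDerivation Ax Γ (φ ∷ prior)

-- All rules, including substitution, apply to the elements of Γ too.
_⊢⟨_⟩_ : {P : Set ℓ} →
         Pred (Form P) g → Pred (Form P) a → Form P → Set (ℓ ⊔ a ⊔ g)
Γ ⊢⟨ Ax ⟩ φ = ∃[ prior ] IsDerivation Ax Γ (φ ∷ prior)

Theorem : {P : Set ℓ} → Pred (Form P) a → Form P → Set (ℓ ⊔ a)
Theorem Ax φ = ∅ ⊢⟨ Ax ⟩ φ

{-# OPTIONS --safe #-}
module Submission where

-- The canonical model has as states the maximal sets consistent with the
-- logic L of Γ (the formulas derivable from Γ), and s R t when t contains
-- every φ with φ, ○ φ ∈ s.  The formulas φ with φ, ○ φ ∈ s are closed under
-- derivation in L: modus ponens is handled by ○∧ and the ○-rule.  So if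
-- ○ ψ ∉ s, then ψ is not derivable from them, and some successor of s omits ψ.
-- Axiom 4 makes R transitive.  As Γ ⊆ L, all states satisfy Γ.  Maximal sets
-- exist by Zorn's lemma; choice is available because excluded middle for all
-- types yields an element of every nonempty one.

open import Defs
open import Axiom.ExcludedMiddle using (ExcludedMiddle)
open import Axiom.Extensionality.Propositional using (Extensionality; lower-extensionality)
open import Data.Bool.Base using (Bool; true; false) renaming (_∧_ to _∧ᵇ_; _∨_ to _∨ᵇ_)
open import Data.Bool.Properties using (_≟_; ⇔→≡; ∨-zeroʳ)
open import Data.List.Base using ([]; _∷_; _++_)
open import Data.List.Membership.Propositional.Properties using (∈-++⁺ˡ; ∈-++⁺ʳ)
open import Data.List.Relation.Binary.Subset.Propositional using (_⊆_)
open import Data.List.Relation.Unary.All using (All; []; _∷_; lookup)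
open import Data.List.Relation.Unary.Any using (here; there)
open import Data.Product.Base using (_×_; _,_; proj₂; ∃-syntax)
open import Data.Sum.Base using (_⊎_; inj₁; inj₂; [_,_]′)
open import Function.Base using (id; _∘_)
open import Function.Bundles using (mk⇔)
open import Level using (Level; Lift; lift; lower)
open import Relation.Binary.PropositionalEquality.Core
  using (_≡_; _≢_; refl; sym; trans; cong; cong₂) renaming (subst to transport)
open import Relation.Nullary.Decidable using (Dec; yes; no; does; proof; decidable-stable; dec-true)
open import Relation.Nullary.Negation.Core using (contradiction) renaming (¬_ to Not)
open import Relation.Nullary.Reflects using (Reflects; ofʸ; ¬-reflects; _×-reflects_)
open import Relation.Unary using (Pred; ∅)

private variable
  ℓ a g : Level
  P     : Set ℓ

-- Boolean-valued subsets

witness : {A : Set ℓ} (a? : Dec A) → does a? ≡ true → A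
witness (yes x) _ = x

-- With values in `Bool` rather than in a universe, even `Subset (Subset A)` stays at level ℓ, where
-- excluded middle applies, and mutual inclusion yields equality by extensionality.
Subset : Set ℓ → Set ℓ
Subset A = A → Bool

module _ {A : Set ℓ} where

  infix 4 _∋_ _⊑_

  _∋_ : Subset A → A → Set
  X ∋ x = X x ≡ true

  _⊑_ : Subset A → Subset A → Set ℓ
  X ⊑ Y = ∀ x → X ∋ x → Y ∋ x

  Chain : Subset (Subset A) → Set ℓ
  Chain F = ∀ {X Y} → F X ≡ true → F Y ≡ true → X ⊑ Y ⊎ Y ⊑ X

  ⊑-trans : ∀ {X Y Z} → X ⊑ Y → Y ⊑ Z → X ⊑ Z
  ⊑-trans f h x = h x ∘ f x

  ⊑-antisym : Extensionality ℓ ℓ → ∀ {X Y} → X ⊑ Y → Y ⊑ X → X ≡ Y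
  ⊑-antisym ext f h =
    lower-extensionality ℓ ℓ ext λ x → ⇔→≡ (mk⇔ (f x) (h x))

  module _ (em : ExcludedMiddle ℓ) where

    insert : A → Subset A → Subset A
    insert a X x = does (em {x ≡ a}) ∨ᵇ X x

    insert-here : ∀ a X → insert a X ∋ a
    insert-here a X = cong (_∨ᵇ X a) (dec-true em refl)

    insert-⊒ : ∀ a X → X ⊑ insert a X
    insert-⊒ a X x Xx = trans (cong (_ ∨ᵇ_) Xx) (∨-zeroʳ _)

    insert⁻ : ∀ a X {x} → insert a X ∋ x → x ≡ a ⊎ X ∋ x
    insert⁻ a X {x} h with em {x ≡ a}
    ... | yes e = inj₁ e
    ... | no _  = inj₂ h

    ⋃ : Subset (Subset A) → Subset A
    ⋃ F x = does (em {∃[ X ] (F X ≡ true × X ∋ x)})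

    ⋃-upper : ∀ {F X} → F X ≡ true → X ⊑ ⋃ F
    ⋃-upper FX x Xx = dec-true em (_ , FX , Xx)

    ⋃⁻ : ∀ {F x} → ⋃ F ∋ x → ∃[ X ] (F X ≡ true × X ∋ x)
    ⋃⁻ = witness em

-- Zorn's lemma

-- The Bourbaki–Witt argument: iterating a choice of proper extensions
-- transfinitely, from B on, yields a chain, whose union admits no further
-- extension.
module Zorn {A : Set ℓ} (em : ExcludedMiddle ℓ) (ext : Extensionality ℓ ℓ)
  (C : Subset A → Set ℓ)
  (C-⋃ : ∀ F → ∃[ X ] F X ≡ true → Chain F → (∀ X → F X ≡ true → C X) → C (⋃ em F))
  (B : Subset A) (C-B : C B) where

  private
    Extension : Subset A → Set ℓ
    Extension X = ∃[ a ] (Not (X ∋ a) × C (insert em a X))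

    enlarge : ∀ X → Dec (Extension X) → Subset A
    enlarge X (yes (a , _)) = insert em a X
    enlarge X (no _)        = X

    next : Subset A → Subset A
    next X = enlarge X em

    next-⊒ : ∀ X → X ⊑ next X
    next-⊒ X with em {Extension X}
    ... | yes (a , _) = insert-⊒ em a X
    ... | no _        = λ _ → id

    next-C : ∀ {X} → C X → C (next X)
    next-C {X} c with em {Extension X}
    ... | yes (_ , _ , c′) = c′
    ... | no _             = c

    next-⊑⇒¬Extension : ∀ {X} → next X ⊑ X → Not (Extension X)
    next-⊑⇒¬Extension {X} h e with em {Extension X}
    ... | yes (a , a∉X , _) = a∉X (h a (insert-here em a X))
    ... | no ¬e             = ¬e e

    -- `sup` asks for no chain: that any two towers are comparable is proved in `linear`, and then
    -- meets the chain hypothesis of `C-⋃`.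
    data Tower : Subset A → Set ℓ where
      base : Tower B
      step : ∀ {X} → Tower X → Tower (next X)
      sup  : ∀ F → ∃[ X ] F X ≡ true → (∀ X → F X ≡ true → Tower X) → Tower (⋃ em F)

    B-least : ∀ {X} → Tower X → B ⊑ X
    B-least base                = λ _ → id
    B-least (step t)            = ⊑-trans (B-least t) (next-⊒ _)
    B-least (sup F (X , FX) ts) = ⊑-trans (B-least (ts X FX)) (⋃-upper em FX)

    -- The extreme points of Bourbaki-Witt: `next` never jumps from properly below X to outside X.
    -- Properness is expressed by the failure of the converse inclusion.
    Extreme : Subset A → Set ℓ
    Extreme X = ∀ {Y} → Tower Y → Y ⊑ X → Not (X ⊑ Y) → next Y ⊑ X

    -- Induction on Y: a step from properly below X stays inside X by extremeness, and a step from X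
    -- itself lands on `next X`.
    compare : ∀ {X Y} → Tower X → Extreme X → Tower Y → Y ⊑ X ⊎ next X ⊑ Y
    compare tX eX base = inj₁ (B-least tX)
    compare {X} tX eX (step {Y} tY) with compare tX eX tY
    ... | inj₂ h = inj₂ (⊑-trans h (next-⊒ Y))
    ... | inj₁ h with em {X ⊑ Y}
    ...   | no n  = inj₁ (eX tY h n)
    ...   | yes k with refl ← ⊑-antisym ext h k = inj₂ λ _ → id
    -- Either some member already contains `next X`, or by induction every member, hence the union,
    -- lies inside X.
    compare {X} tX eX (sup F _ ts) with em {∃[ Y ] (F Y ≡ true × next X ⊑ Y)}
    ... | yes (Y , FY , h) = inj₂ (⊑-trans h (⋃-upper em FY))
    ... | no n             = inj₁ λ x ⋃x → let (Y , FY , Yx) = ⋃⁻ em ⋃x in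
      [ (λ h → h x Yx) , (λ h → contradiction (Y , FY , h) n) ]′ (compare tX eX (ts Y FY))

    extreme : ∀ {X} → Tower X → Extreme X
    extreme base tY _ n = contradiction (B-least tY) n
    -- As `next X` is not inside Y, comparison leaves Y inside X: properly, or equal to it.
    extreme (step {X} tX) {Y} tY h n with compare tX (extreme tX) tY
    ... | inj₂ k = contradiction k n
    ... | inj₁ k with em {X ⊑ Y}
    ...   | no m  = ⊑-trans (extreme tX tY k m) (next-⊒ X)
    ...   | yes m with refl ← ⊑-antisym ext k m = λ _ → id
    -- As the union is not inside Y, some member Z is not; comparison then puts Y properly inside Z,
    -- which is extreme by induction.
    extreme (sup F _ ts) {Y} tY h n with em {∃[ Z ] (F Z ≡ true × Not (Z ⊑ Y))}
    ... | no m = contradiction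
      (λ x ⋃x → let (Z , FZ , Zx) = ⋃⁻ em ⋃x in
        decidable-stable em (λ k → m (Z , FZ , k)) x Zx) n
    ... | yes (Z , FZ , m) with compare (ts Z FZ) (extreme (ts Z FZ)) tY
    ...   | inj₁ k = ⊑-trans (extreme (ts Z FZ) tY k m) (⋃-upper em FZ)
    ...   | inj₂ k = contradiction (⊑-trans (next-⊒ Z) k) m

    linear : ∀ {X Y} → Tower X → Tower Y → X ⊑ Y ⊎ Y ⊑ X
    linear {X} tX tY =
      [ inj₂ , inj₁ ∘ ⊑-trans (next-⊒ X) ]′ (compare tX (extreme tX) tY)

    Tower-C : ∀ {X} → Tower X → C X
    Tower-C base         = C-B
    Tower-C (step t)     = next-C (Tower-C t)
    Tower-C (sup F i ts) =
      C-⋃ F i (λ FX FY → linear (ts _ FX) (ts _ FY)) (λ X FX → Tower-C (ts X FX))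

    towers : Subset (Subset A)
    towers X = does (em {Tower X})

    -- The towers themselves form a `Subset (Subset A)`, so `sup` applies to all of them at once and
    -- gives the largest.
    max-Tower : Tower (⋃ em towers)
    max-Tower = sup towers (B , dec-true em base) (λ _ → witness em)

  max : Subset A
  max = ⋃ em towers

  max-C : C max
  max-C = Tower-C max-Tower

  B⊑max : B ⊑ max
  B⊑max = B-least max-Tower

  -- `next max` is again a tower, hence inside `max`; so `next` found nothing to add.
  max-maximal : ∀ a → C (insert em a max) → max ∋ a
  max-maximal a c = decidable-stable (max a ≟ true) λ a∉ →
    next-⊑⇒¬Extension (⋃-upper em (dec-true em (step max-Tower))) (a , a∉ , c)

-- Derivation sequences

module _ {Ax : Pred (Form P) a} {Γ : Pred (Form P) g} where

  Justified-mono : ∀ {xs ys φ} → xs ⊆ ys → Justified Ax Γ xs φ → Justified Ax Γ ys φ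
  Justified-mono i (axiom x σ) = axiom x σ
  Justified-mono i (member x)  = member x
  Justified-mono i (subst m σ) = subst (i m) σ
  Justified-mono i (mp m n)    = mp (i m) (i n)
  Justified-mono i (○-rule m)  = ○-rule (i m)

  infixr 5 _++ᴰ_

  _++ᴰ_ : ∀ {xs ys} → IsDerivation Ax Γ xs → IsDerivation Ax Γ ys → IsDerivation Ax Γ (xs ++ ys)
  []      ++ᴰ E = E
  (j ∷ D) ++ᴰ E = Justified-mono ∈-++⁺ˡ j ∷ (D ++ᴰ E)

  ⊢-axiom : ∀ {φ} → Ax φ → ∀ σ → Γ ⊢⟨ Ax ⟩ (φ [ σ ])
  ⊢-axiom x σ = [] , axiom x σ ∷ []

  ⊢-member : ∀ {φ} → Γ φ → Γ ⊢⟨ Ax ⟩ φ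
  ⊢-member x = [] , member x ∷ []

  ⊢-mp : ∀ {φ ψ} → Γ ⊢⟨ Ax ⟩ (φ ⇒ ψ) → Γ ⊢⟨ Ax ⟩ φ → Γ ⊢⟨ Ax ⟩ ψ
  ⊢-mp (xs , D) (ys , E) =
    _ , mp (here refl) (there (∈-++⁺ʳ xs (here refl))) ∷ (D ++ᴰ E)

  ⊢-○-rule : ∀ {φ ψ} → Γ ⊢⟨ Ax ⟩ (φ ⇒ ψ) → Γ ⊢⟨ Ax ⟩ (○ φ ∧ φ ⇒ ○ ψ)
  ⊢-○-rule (xs , D) = _ , ○-rule (here refl) ∷ D

-- Axioms enter derivations only under a substitution; a tautology is used as it stands by
-- instantiating it with `var`.
[var]-identity : (φ : Form P) → φ [ var ] ≡ φ
[var]-identity (var r) = refl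
[var]-identity (¬ φ)   = cong ¬_ ([var]-identity φ)
[var]-identity (φ ∧ ψ) = cong₂ _∧_ ([var]-identity φ) ([var]-identity ψ)
[var]-identity (○ φ)   = cong ○_ ([var]-identity φ)

-- Soundness

module Soundness {ℓ} (em : ExcludedMiddle ℓ) {P : Set ℓ} where

  ⇒-elim : {A B : Set ℓ} → Not (A × Not B) → A → B
  ⇒-elim f x = decidable-stable em λ nb → f (x , nb)

  ⇒-intro : {A B : Set ℓ} → (A → B) → Not (A × Not B)
  ⇒-intro f (x , nb) = nb (f x)

  -- Truth at a state is a Boolean valuation once circled formulas count as atoms, so tautologies
  -- hold at every state.
  eval-reflects : (M : Model P) (s : Model.S M) (φ : Form P) →
    Reflects (M ⟨ s ⟩⊨ φ)
      (eval (λ r → does (em {Model.V M r s})) (λ ψ → does (em {M ⟨ s ⟩⊨ (○ ψ)})) φ)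
  eval-reflects M s (var r) = proof em
  eval-reflects M s (¬ φ)   = ¬-reflects (eval-reflects M s φ)
  eval-reflects M s (φ ∧ ψ) = eval-reflects M s φ ×-reflects eval-reflects M s ψ
  eval-reflects M s (○ φ)   = proof em

  Tautology⇒⊨ : ∀ φ → Tautology φ → (M : Model P) → ∀ s → M ⟨ s ⟩⊨ φ
  Tautology⇒⊨ φ t M s with ofʸ x ← transport (Reflects _) (t _ _) (eval-reflects M s φ) = x

  -- Substitution is absorbed into the valuation. The frame is kept, so the new model stays in any
  -- frame class.
  _[_]ᴹ : Model P → (P → Form P) → Model P
  M [ σ ]ᴹ = record { frame = Model.frame M ; V = λ r s → M ⟨ s ⟩⊨ σ r }

  mutual
    -- The two directions call each other because negation and the premise hidden in `○` reverse
    -- them.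
    ⊨-subst⁺ : ∀ M σ s φ → (M [ σ ]ᴹ) ⟨ s ⟩⊨ φ → M ⟨ s ⟩⊨ (φ [ σ ])
    ⊨-subst⁺ M σ s (var r) h       = h
    ⊨-subst⁺ M σ s (¬ φ)   h       = h ∘ ⊨-subst⁻ M σ s φ
    ⊨-subst⁺ M σ s (φ ∧ ψ) (h , k) = ⊨-subst⁺ M σ s φ h , ⊨-subst⁺ M σ s ψ k
    ⊨-subst⁺ M σ s (○ φ)   h x t r = ⊨-subst⁺ M σ t φ (h (⊨-subst⁻ M σ s φ x) t r)

    ⊨-subst⁻ : ∀ M σ s φ → M ⟨ s ⟩⊨ (φ [ σ ]) → (M [ σ ]ᴹ) ⟨ s ⟩⊨ φ
    ⊨-subst⁻ M σ s (var r) h       = h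
    ⊨-subst⁻ M σ s (¬ φ)   h       = h ∘ ⊨-subst⁺ M σ s φ
    ⊨-subst⁻ M σ s (φ ∧ ψ) (h , k) = ⊨-subst⁻ M σ s φ h , ⊨-subst⁻ M σ s ψ k
    ⊨-subst⁻ M σ s (○ φ)   h x t r = ⊨-subst⁻ M σ t φ (h (⊨-subst⁺ M σ s φ x) t r)

  Valid-subst : ∀ {F : FrameClass ℓ a} φ σ → Valid F φ → Valid F (φ [ σ ])
  Valid-subst φ σ v M f s = ⊨-subst⁺ M σ s φ (v (M [ σ ]ᴹ) f s)

  K°-valid : ∀ {F : FrameClass ℓ a} {p q φ} → K°Axiom p q φ → Valid F φ
  K°-valid (taut {φ} t) M _ s = Tautology⇒⊨ φ t M s
  K°-valid ○⊤       M _ s = λ _ t _ → ⇒-intro id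
  K°-valid ¬⇒○      M _ s = ⇒-intro λ ¬p p → contradiction p ¬p
  K°-valid ○∧       M _ s = ⇒-intro λ (○p , ○q) (p , q) t r → ○p p t r , ○q q t r

  K4°-valid : ∀ {p q : P} {φ} → K4°Axiom p q φ → Valid TransitiveFrames φ
  K4°-valid (K° x) = K°-valid x
  K4°-valid ax4 M tr s = ⇒-intro λ (○p , p) _ t st _ u tu → ○p p u (tr st tu)

  -- The induction carries validity, not truth at one state: `subst` changes the model and `○-rule`
  -- moves to a successor. `member` cannot occur, as the premise set is empty.
  justified-valid : ∀ {F : FrameClass ℓ a} {Ax : Pred (Form P) g} → (∀ {φ} → Ax φ → Valid F φ) →
    ∀ {xs φ} → All (Valid F) xs → Justified Ax ∅ xs φ → Valid F φ
  justified-valid ax vs (axiom {φ} x σ) = Valid-subst φ σ (ax x)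
  justified-valid ax vs (subst {φ} m σ) = Valid-subst φ σ (lookup vs m)
  justified-valid ax vs (mp m n) M f s  = ⇒-elim (lookup vs m M f s) (lookup vs n M f s)
  justified-valid ax vs (○-rule m) M f s =
    ⇒-intro λ (○φ , φ) _ t r → ⇒-elim (lookup vs m M f t) (○φ φ t r)

  derivation-valid : ∀ {F : FrameClass ℓ a} {Ax : Pred (Form P) g} → (∀ {φ} → Ax φ → Valid F φ) →
    ∀ {xs} → IsDerivation Ax ∅ xs → All (Valid F) xs
  derivation-valid ax []      = []
  derivation-valid ax (j ∷ D) = let vs = derivation-valid ax D in justified-valid ax vs j ∷ vs

  soundness : ∀ {p q : P} φ → Theorem (K4°Axiom p q) φ → Valid TransitiveFrames φ
  soundness φ (_ , D) with v ∷ _ ← derivation-valid K4°-valid D = v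

-- Tautologies for the completeness proof

taut-id : (φ : Form P) → Tautology (φ ⇒ φ)
taut-id φ v w with eval v w φ
... | true  = refl
... | false = refl

module _ {P : Set ℓ} (φ ψ : Form P) where

  taut-const : Tautology (φ ⇒ ψ ⇒ φ)
  taut-const v w with eval v w φ | eval v w ψ
  ... | false | _     = refl
  ... | true  | false = refl
  ... | true  | true  = refl

  taut-distrib : ∀ χ → Tautology ((φ ⇒ ψ ⇒ χ) ⇒ (φ ⇒ ψ) ⇒ φ ⇒ χ)
  taut-distrib χ v w with eval v w φ | eval v w ψ | eval v w χ
  ... | false | _     | _     = refl
  ... | true  | false | false = refl
  ... | true  | false | true  = refl
  ... | true  | true  | false = refl
  ... | true  | true  | true  = refl

  taut-pair : Tautology (φ ⇒ ψ ⇒ φ ∧ ψ)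
  taut-pair v w with eval v w φ | eval v w ψ
  ... | false | _     = refl
  ... | true  | false = refl
  ... | true  | true  = refl

  taut-fst : Tautology (φ ∧ ψ ⇒ φ)
  taut-fst v w with eval v w φ | eval v w ψ
  ... | false | _     = refl
  ... | true  | false = refl
  ... | true  | true  = refl

  taut-snd : Tautology (φ ∧ ψ ⇒ ψ)
  taut-snd v w with eval v w φ | eval v w ψ
  ... | false | _     = refl
  ... | true  | false = refl
  ... | true  | true  = refl

  taut-apply : Tautology ((φ ⇒ ψ) ∧ φ ⇒ ψ)
  taut-apply v w with eval v w φ | eval v w ψ
  ... | false | false = refl
  ... | false | true  = refl
  ... | true  | false = refl
  ... | true  | true  = refl

  taut-explode : Tautology (φ ⇒ ¬ φ ⇒ ψ)
  taut-explode v w with eval v w φ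
  ... | false = refl
  ... | true  = refl

-- Reductio, with `¬ top p` as falsum; its value computes only after a split on `v p`.
taut-raa : ∀ {P : Set ℓ} (p : P) φ → Tautology ((¬ φ ⇒ ¬ top p) ⇒ φ)
taut-raa p φ v w with eval v w φ | v p
... | true  | true  = refl
... | true  | false = refl
... | false | true  = refl
... | false | false = refl

-- Theorems and axiom instances in the logic of Γ

module Completeness {ℓ} (em : ExcludedMiddle ℓ) (ext : Extensionality ℓ ℓ)
  {P : Set ℓ} {p q : P} (p≢q : p ≢ q) (Γ : Pred (Form P) ℓ) where

  infix 4 ⊢_ _⊩_

  ⊢_ : Pred (Form P) ℓ
  ⊢ φ = Γ ⊢⟨ K4°Axiom p q ⟩ φ

  ⊢-taut : ∀ φ → Tautology φ → ⊢ φ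
  ⊢-taut φ t = transport ⊢_ ([var]-identity φ) (⊢-axiom (K° (taut {φ = φ} t)) var)

  ⊢-id : ∀ {φ} → ⊢ φ ⇒ φ
  ⊢-id {φ} = ⊢-taut (φ ⇒ φ) (taut-id φ)

  ⊢-const : ∀ {φ ψ} → ⊢ φ ⇒ ψ ⇒ φ
  ⊢-const {φ} {ψ} = ⊢-taut (φ ⇒ ψ ⇒ φ) (taut-const φ ψ)

  ⊢-distrib : ∀ {φ ψ χ} → ⊢ (φ ⇒ ψ ⇒ χ) ⇒ (φ ⇒ ψ) ⇒ φ ⇒ χ
  ⊢-distrib {φ} {ψ} {χ} = ⊢-taut ((φ ⇒ ψ ⇒ χ) ⇒ (φ ⇒ ψ) ⇒ φ ⇒ χ) (taut-distrib φ ψ χ)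

  ⊢-pair : ∀ {φ ψ} → ⊢ φ ⇒ ψ ⇒ φ ∧ ψ
  ⊢-pair {φ} {ψ} = ⊢-taut (φ ⇒ ψ ⇒ φ ∧ ψ) (taut-pair φ ψ)

  ⊢-fst : ∀ {φ ψ} → ⊢ φ ∧ ψ ⇒ φ
  ⊢-fst {φ} {ψ} = ⊢-taut (φ ∧ ψ ⇒ φ) (taut-fst φ ψ)

  ⊢-snd : ∀ {φ ψ} → ⊢ φ ∧ ψ ⇒ ψ
  ⊢-snd {φ} {ψ} = ⊢-taut (φ ∧ ψ ⇒ ψ) (taut-snd φ ψ)

  ⊢-apply : ∀ {φ ψ} → ⊢ (φ ⇒ ψ) ∧ φ ⇒ ψ
  ⊢-apply {φ} {ψ} = ⊢-taut ((φ ⇒ ψ) ∧ φ ⇒ ψ) (taut-apply φ ψ)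

  ⊢-explode : ∀ {φ ψ} → ⊢ φ ⇒ ¬ φ ⇒ ψ
  ⊢-explode {φ} {ψ} = ⊢-taut (φ ⇒ ¬ φ ⇒ ψ) (taut-explode φ ψ)

  ⊢-raa : ∀ {φ} → ⊢ (¬ φ ⇒ ¬ top p) ⇒ φ
  ⊢-raa {φ} = ⊢-taut ((¬ φ ⇒ ¬ top p) ⇒ φ) (taut-raa p φ)

  choose : (φ ψ : Form P) {r : P} → Dec (r ≡ p) → Form P
  choose φ ψ (yes _) = φ
  choose φ ψ (no _)  = ψ

  -- Built for instances of `○∧`, which need independent images for p and q; their distinctness
  -- makes this possible.
  [p↦_,q↦_] : Form P → Form P → P → Form P
  [p↦ φ ,q↦ ψ ] r = choose φ ψ (em {r ≡ p})

  at-p : ∀ φ ψ → [p↦ φ ,q↦ ψ ] p ≡ φ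
  at-p φ ψ with em {p ≡ p}
  ... | yes _ = refl
  ... | no n  = contradiction refl n

  at-q : ∀ φ ψ → [p↦ φ ,q↦ ψ ] q ≡ ψ
  at-q φ ψ with em {q ≡ p}
  ... | yes e = contradiction (sym e) p≢q
  ... | no _  = refl

  ⊢-○⊤ : ⊢ ○ top p
  ⊢-○⊤ = ⊢-axiom (K° ○⊤) var

  ⊢-¬⇒○ : ∀ φ → ⊢ ¬ φ ⇒ ○ φ
  -- The only variable of this axiom is p, so a constant substitution gives the instance.
  ⊢-¬⇒○ φ = ⊢-axiom (K° ¬⇒○) λ _ → φ

  ⊢-ax4 : ∀ φ → ⊢ ○ φ ∧ φ ⇒ ○ ○ φ
  ⊢-ax4 φ = ⊢-axiom ax4 λ _ → φ

  ⊢-○∧ : ∀ φ ψ → ⊢ ○ φ ∧ ○ ψ ⇒ ○ (φ ∧ ψ)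
  ⊢-○∧ φ ψ = transport ⊢_
    (cong₂ (λ α β → ○ α ∧ ○ β ⇒ ○ (α ∧ β)) (at-p φ ψ) (at-q φ ψ))
    (⊢-axiom (K° ○∧) [p↦ φ ,q↦ ψ ])

  -- Hypotheses in X are subject to modus ponens only, which makes the deduction theorem hold.
  -- Substitution and the `○`-rule are confined to `⊢_`, where they act on Γ as well.
  data _⊩_ (X : Subset (Form P)) : Form P → Set ℓ where
    hyp : ∀ {φ} → X ∋ φ → X ⊩ φ
    thm : ∀ {φ} → ⊢ φ → X ⊩ φ
    mp  : ∀ {φ ψ} → X ⊩ φ ⇒ ψ → X ⊩ φ → X ⊩ ψ

  ⊩-mono : ∀ {X Y φ} → X ⊑ Y → X ⊩ φ → Y ⊩ φ
  ⊩-mono i (hyp x)  = hyp (i _ x)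
  ⊩-mono i (thm x)  = thm x
  ⊩-mono i (mp d e) = mp (⊩-mono i d) (⊩-mono i e)

  deduction : ∀ {X φ ψ} → insert em φ X ⊩ ψ → X ⊩ φ ⇒ ψ
  deduction {X} {φ} (hyp x) with insert⁻ em φ X x
  ... | inj₁ refl = thm ⊢-id
  ... | inj₂ Xψ   = mp (thm ⊢-const) (hyp Xψ)
  deduction (thm x)  = mp (thm ⊢-const) (thm x)
  deduction (mp d e) =
    mp (mp (thm ⊢-distrib) (deduction d)) (deduction e)

  Consistent : Subset (Form P) → Set ℓ
  Consistent X = Not (X ⊩ ¬ top p)

  -- In a chain, the two premises of `mp` can both be derived from the larger of two members.
  -- Nonemptiness supplies a member for `thm`.
  ⊩-compact : ∀ F → ∃[ X ] F X ≡ true → Chain F → ∀ {φ} → ⋃ em F ⊩ φ →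
    ∃[ X ] (F X ≡ true × X ⊩ φ)
  ⊩-compact F i ch (hyp x) = let (X , FX , Xx) = ⋃⁻ em x in X , FX , hyp Xx
  ⊩-compact F (X , FX) ch (thm x) = X , FX , thm x
  ⊩-compact F i ch (mp d e) with ⊩-compact F i ch d | ⊩-compact F i ch e
  ... | X , FX , d′ | Y , FY , e′ with ch FX FY
  ...   | inj₁ h = Y , FY , mp (⊩-mono h d′) e′
  ...   | inj₂ h = X , FX , mp d′ (⊩-mono h e′)

  Consistent-⋃ : ∀ F → ∃[ X ] F X ≡ true → Chain F → (∀ X → F X ≡ true → Consistent X) →
    Consistent (⋃ em F)
  Consistent-⋃ F i ch cs d = let (X , FX , d′) = ⊩-compact F i ch d in cs X FX d′

  -- Maximal consistent sets

  record State : Set ℓ where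
    field
      set        : Subset (Form P)
      consistent : Consistent set
      maximal    : ∀ φ → Consistent (insert em φ set) → set ∋ φ

    closed : ∀ {φ} → set ⊩ φ → set ∋ φ
    -- Were adding φ inconsistent, the deduction theorem would refute φ from the set, against `d`.
    closed d = maximal _ λ e → consistent (mp (deduction e) d)

    infixl 6 _·_
    _·_ : ∀ {φ ψ} → set ∋ φ ⇒ ψ → set ∋ φ → set ∋ ψ
    d · e = closed (mp (hyp d) (hyp e))

    theorem : ∀ {φ} → ⊢ φ → set ∋ φ
    theorem = closed ∘ thm

    pair : ∀ {φ ψ} → set ∋ φ → set ∋ ψ → set ∋ φ ∧ ψ
    pair d e = theorem ⊢-pair · d · e

    exclusive : ∀ {φ} → set ∋ φ → Not (set ∋ ¬ φ)
    exclusive d e = consistent (hyp (theorem ⊢-explode · d · e))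

    exhaustive : ∀ {φ} → Not (set ∋ φ) → set ∋ ¬ φ
    exhaustive n = maximal _ λ e →
      n (closed (mp (thm ⊢-raa) (deduction e)))

  open State

  -- Lindenbaum's lemma
  refute : ∀ {X φ} → Not (X ⊩ φ) → ∃[ s ] (X ⊑ set s × Not (set s ∋ φ))
  refute {X} {φ} n = s , ⊑-trans (insert-⊒ em _ X) B⊑max ,
      λ φ∈ → exclusive s φ∈ (B⊑max _ (insert-here em (¬ φ) X))
    where
    -- The iteration starts from X with `¬ φ` added; an inconsistency there would derive φ from X by
    -- reductio.
    open Zorn em ext Consistent Consistent-⋃ (insert em (¬ φ) X)
      (λ d → n (mp (thm ⊢-raa) (deduction d)))
    s : State
    s = record { set = max ; consistent = max-C ; maximal = max-maximal }

  -- The canonical model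

  -- As ○ φ means φ → □ φ, these are the φ for which s contains φ ∧ □ φ.
  necessary : State → Subset (Form P)
  necessary s φ = set s φ ∧ᵇ set s (○ φ)

  necessary⁺ : ∀ s {φ} → set s ∋ φ → set s ∋ ○ φ → necessary s ∋ φ
  necessary⁺ s = cong₂ _∧ᵇ_

  necessary⁻ : ∀ s {φ} → necessary s ∋ φ → set s ∋ φ × set s ∋ ○ φ
  necessary⁻ s {φ} h with true ← set s φ = refl , h

  -- `○ φ` also holds where φ fails, so the circle passes to a consequence only with φ itself in s.
  ○-mono : ∀ s {φ ψ} → ⊢ φ ⇒ ψ → set s ∋ φ → set s ∋ ○ φ → set s ∋ ○ ψ
  ○-mono s d φ∈ ○φ∈ = _·_ s (theorem s (⊢-○-rule d)) (pair s ○φ∈ φ∈)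

  necessary-closed : ∀ s {φ} → necessary s ⊩ φ → set s ∋ φ × set s ∋ ○ φ
  necessary-closed s (hyp x) = necessary⁻ s x
  -- A theorem is implied by `top p`, whose circle is an axiom.
  necessary-closed s (thm x) = theorem s x ,
    ○-mono s (⊢-mp ⊢-const x)
      (theorem s ⊢-id) (theorem s ⊢-○⊤)
  necessary-closed s (mp d e) with necessary-closed s d | necessary-closed s e
  ... | d∈ , ○d∈ | e∈ , ○e∈ = _·_ s d∈ e∈ ,
    -- `○∧` merges the two circled premises into one circled conjunction, to which the one-premise
    -- `○`-rule applies.
    ○-mono s ⊢-apply (pair s d∈ e∈)
      (_·_ s (theorem s (⊢-○∧ _ _)) (pair s ○d∈ ○e∈))

  _↝_ : State → State → Set ℓ
  s ↝ t = necessary s ⊑ set t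

  -- Axiom 4 makes `○ φ` necessary at s along with φ. So t contains both, φ is necessary at t, and u
  -- contains φ.
  ↝-trans : ∀ {s t u} → s ↝ t → t ↝ u → s ↝ u
  ↝-trans {s} {t} {u} st tu φ h with necessary⁻ s h
  ... | φ∈ , ○φ∈ = tu φ (necessary⁺ t (st φ h) (st (○ φ) (necessary⁺ s ○φ∈ ○○φ∈)))
    where ○○φ∈ = _·_ s (theorem s (⊢-ax4 φ)) (pair s ○φ∈ φ∈)

  canonical : State → Model P
  canonical s = record
    { frame = record { S = State ; R = _↝_ ; nonempty = s }
    ; V     = λ r t → Lift ℓ (set t ∋ var r)
    }

  module _ (s₀ : State) where
    mutual
      truth⁺ : ∀ φ s → canonical s₀ ⟨ s ⟩⊨ φ → set s ∋ φ
      truth⁺ (var r) s h       = lower h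
      truth⁺ (¬ φ)   s h       = exhaustive s (h ∘ truth⁻ φ s)
      truth⁺ (φ ∧ ψ) s (h , k) = pair s (truth⁺ φ s h) (truth⁺ ψ s k)
      truth⁺ (○ φ)   s h with em {necessary s ⊩ φ}
      ... | yes d = proj₂ (necessary-closed s d)
      -- Some successor t omits φ. If φ were in s, then `h` would put it in t; so `¬ φ` is in s, and
      -- this implies `○ φ`.
      ... | no n  = let (t , st , φ∉t) = refute n in
        _·_ s (theorem s (⊢-¬⇒○ φ)) (exhaustive s λ φ∈ →
          φ∉t (truth⁺ φ t (h (truth⁻ φ s φ∈) t st)))

      truth⁻ : ∀ φ s → set s ∋ φ → canonical s₀ ⟨ s ⟩⊨ φ
      truth⁻ (var r) s h = lift h
      truth⁻ (¬ φ)   s h = λ k → exclusive s (truth⁺ φ s k) h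
      truth⁻ (φ ∧ ψ) s h =
        truth⁻ φ s (_·_ s (theorem s ⊢-fst) h) ,
        truth⁻ ψ s (_·_ s (theorem s ⊢-snd) h)
      truth⁻ (○ φ)   s h k t st = truth⁻ φ t (st φ (necessary⁺ s (truth⁺ φ s k) h))

  -- Strong completeness

  ⊩⇒⊢ : ∀ {φ} → (λ _ → false) ⊩ φ → ⊢ φ
  ⊩⇒⊢ (thm x)  = x
  ⊩⇒⊢ (mp d e) = ⊢-mp (⊩⇒⊢ d) (⊩⇒⊢ e)

  completeness : ∀ φ → Γ ⊨⟨ TransitiveFrames ⟩ φ → ⊢ φ
  completeness φ v = decidable-stable em λ n →
    -- Γ already lies in every state through `⊢_`, so the refutation starts from no hypotheses.
    let (s , _ , φ∉s) = refute {λ _ → false} (n ∘ ⊩⇒⊢) in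
    φ∉s (truth⁺ s φ s (v (canonical s) (λ {i} {j} {k} → ↝-trans {i} {j} {k}) s
      λ γ γ∈Γ → truth⁻ s γ s (theorem s (⊢-member γ∈Γ))))

theorem37 : ∀ {ℓ} → ExcludedMiddle ℓ → Extensionality ℓ ℓ →
    (P : Set ℓ) (p q : P) → p ≢ q →
    (∀ (φ : Form P) → Theorem (K4°Axiom p q) φ → Valid TransitiveFrames φ)
    × (∀ (Γ : Pred (Form P) ℓ) (φ : Form P) →
    Γ ⊨⟨ TransitiveFrames ⟩ φ → Γ ⊢⟨ K4°Axiom p q ⟩ φ)
theorem37 em ext P p q p≢q =
  Soundness.soundness em , Completeness.completeness em ext p≢q
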